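{- Let $n \ge 5$ be an integer. The set of $n-1$ vertices $\{011\ldots1,\ 1011\ldots1,\ \ldots,\ 11\ldots101\} \subseteq \{0,1\}^n$, consisting for each $i = 1, \ldots, n-1$ of the binary string of length $n$ with a $0$ in the $i$-th coordinate and a $1$ in every other coordinate, is a minimal resolving set for the hypercube $Q^n$.
   Context: The $n$-dimensional hypercube $Q^n$ is the graph with vertex set $\{0,1\}^n$ in which two vertices are adjacent when they differ in exactly one coordinate; the graph distance $d(x,y)$ is the number of coordinates in which $x$ and $y$ differ. For a graph $G=(V,E)$ and an ordered subset $S = \{s_1,\ldots,s_k\} \subseteq V$, put $d(v,S) = (d(v,s_1),\ldots,d(v,s_k))$ for $v \in V$. The set $S$ is a resolving set for $G$ if $d(u,S) \ne d(v,S)$ for all vertices $u \ne v$ of $G$ (whether $S$ is resolving does not depend on the ordering). A resolving set is minimal if no proper subset of it is a resolving set. -}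

module Defs where

open import Data.Bool using (Bool; true; false; _≟_)
open import Data.Empty using (⊥-elim)
open import Data.Fin using (Fin; zero; suc; inject≤)
open import Data.Fin.Properties using (0≢1+n; inject≤-injective; suc-injective)
open import Data.List as List using (List)
open import Data.List.Relation.Binary.Subset.Propositional using (_⊆_)
open import Data.List.Relation.Unary.Unique.Propositional using (Unique)
open import Data.List.Relation.Unary.Unique.Propositional.Properties using (tabulate⁺)
open import Data.Nat using (ℕ; zero; suc; _∸_; _≤_; s≤s)
open import Data.Nat.Properties using (≤-refl; ≤-reflexive; ≤-trans; n≤1+n; m∸n≤m)
open import Data.Product using (∃!; _×_; _,_; proj₁; proj₂)
open import Data.Vec using (Vec; []; _∷_; lookup; replicate; count; tail; zip; _[_]≔_)
open import Relation.Binary.PropositionalEquality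
  using (_≡_; _≢_; refl; sym; cong; cong₂)
open import Relation.Nullary using (¬_; yes; no; ¬?; decidable-stable)

data Walk {V : Set} (Adj : V → V → Set) : V → V → ℕ → Set where
  here : ∀ {x} → Walk Adj x x 0
  step : ∀ {x y z k} → Adj x y → Walk Adj y z k → Walk Adj x z (suc k)

record IsGraphDistance {V : Set} (Adj : V → V → Set) (d : V → V → ℕ) : Set where
  field
    attained : ∀ x y → Walk Adj x y (d x y)
    shortest : ∀ {x y k} → Walk Adj x y k → d x y ≤ k

-- A simple connected graph. The distance function is determined, up to
-- pointwise equality, by the adjacency relation; it is carried as data because
-- it cannot be computed from an arbitrary adjacency relation.
record ConnectedGraph : Set₁ where
  field
    Vertex     : Set
    Adj        : Vertex → Vertex → Set
    adj-sym    : ∀ {x y} → Adj x y → Adj y x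
    adj-irrefl : ∀ {x} → ¬ Adj x x
    d          : Vertex → Vertex → ℕ
    d-distance : IsGraphDistance Adj d

record OrderedSubset (V : Set) : Set where
  constructor orderedSubset
  field
    elements : List V
    distinct : Unique elements

open OrderedSubset public

infix 4 _⊊_
_⊊_ : {V : Set} → OrderedSubset V → OrderedSubset V → Set
T ⊊ S = elements T ⊆ elements S × ¬ (elements S ⊆ elements T)

module _ (G : ConnectedGraph) where
  open ConnectedGraph G

  distances : Vertex → OrderedSubset Vertex → List ℕ
  distances v S = List.map (d v) (elements S)

  Resolving : OrderedSubset Vertex → Set
  Resolving S = ∀ u v → u ≢ v → distances u S ≢ distances v S

  MinimalResolving : OrderedSubset Vertex → Set
  MinimalResolving S = Resolving S × (∀ T → T ⊊ S → ¬ Resolving T)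

DifferInOne : ∀ {n} → Vec Bool n → Vec Bool n → Set
DifferInOne x y = ∃! _≡_ λ i → lookup x i ≢ lookup y i

hamming : ∀ {n} → Vec Bool n → Vec Bool n → ℕ
hamming x y = count (λ ab → ¬? (proj₁ ab ≟ proj₂ ab)) (zip x y)

private
  differ-sym : ∀ {n} {x y : Vec Bool n} → DifferInOne x y → DifferInOne y x
  differ-sym (i , ne , uniq) =
    i , (λ e → ne (sym e)) , λ ne′ → uniq λ e → ne′ (sym e)

  differ-∷ : ∀ {n} a {x y : Vec Bool n} →
             DifferInOne x y → DifferInOne (a ∷ x) (a ∷ y)
  differ-∷ a {x} {y} (i , ne , uniq) = suc i , ne , λ {j} → unique j
    where
    unique : ∀ j → lookup (a ∷ x) j ≢ lookup (a ∷ y) j → suc i ≡ j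
    unique zero    ne′ = ⊥-elim (ne′ refl)
    unique (suc j) ne′ = cong suc (uniq ne′)

  differ-head : ∀ {n a b} (x : Vec Bool n) → a ≢ b → DifferInOne (a ∷ x) (b ∷ x)
  differ-head {a = a} {b} x a≢b = zero , a≢b , λ {j} → unique j
    where
    unique : ∀ j → lookup (a ∷ x) j ≢ lookup (b ∷ x) j → zero ≡ j
    unique zero    _   = refl
    unique (suc j) ne′ = ⊥-elim (ne′ refl)

  walk-∷ : ∀ {n k} a {x y : Vec Bool n} →
           Walk DifferInOne x y k → Walk DifferInOne (a ∷ x) (a ∷ y) k
  walk-∷ a here       = here
  walk-∷ a (step e w) = step (differ-∷ a e) (walk-∷ a w)

  hamming-walk : ∀ {n} (x y : Vec Bool n) → Walk DifferInOne x y (hamming x y)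
  hamming-walk []      []      = here
  hamming-walk (a ∷ x) (b ∷ y) with a ≟ b
  ... | yes refl = walk-∷ a (hamming-walk x y)
  ... | no  a≢b  = step (differ-head x a≢b) (walk-∷ b (hamming-walk x y))

  hamming-refl : ∀ {n} (x : Vec Bool n) → hamming x x ≡ 0
  hamming-refl []      = refl
  hamming-refl (a ∷ x) with a ≟ a
  ... | yes _  = hamming-refl x
  ... | no a≢a = ⊥-elim (a≢a refl)

  lookup-ext : ∀ {n} (x y : Vec Bool n) → (∀ i → lookup x i ≡ lookup y i) → x ≡ y
  lookup-ext []      []      eq = refl
  lookup-ext (a ∷ x) (b ∷ y) eq =
    cong₂ _∷_ (eq zero) (lookup-ext x y λ i → eq (suc i))

  hamming-head : ∀ {n} a b (x y : Vec Bool n) →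
                 hamming (a ∷ x) (b ∷ y) ≤ suc (hamming x y)
  hamming-head a b x y with a ≟ b
  ... | yes _ = n≤1+n _
  ... | no  _ = ≤-refl

  hamming-tail : ∀ {n} a b (x y : Vec Bool n) →
                 hamming x y ≤ hamming (a ∷ x) (b ∷ y)
  hamming-tail a b x y with a ≟ b
  ... | yes _ = ≤-refl
  ... | no  _ = n≤1+n _

  hamming-step : ∀ {n} (x z y : Vec Bool n) →
                 DifferInOne x z → hamming x y ≤ suc (hamming z y)
  hamming-step (a ∷ x) (c ∷ z) (b ∷ y) (zero , ne , uniq)
    with refl ← lookup-ext x z (λ i → decidable-stable (lookup x i ≟ lookup z i)
                                        λ ne′ → 0≢1+n (uniq {suc i} ne′))
    = ≤-trans (hamming-head a b x y) (s≤s (hamming-tail c b x y))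
  hamming-step (a ∷ x) (c ∷ z) (b ∷ y) (suc i , ne , uniq) with a ≟ c
  ... | no a≢c with () ← uniq {zero} a≢c
  ... | yes refl with a ≟ b
  ...   | yes _ = hamming-step x z y (i , ne , λ ne′ → suc-injective (uniq ne′))
  ...   | no  _ = s≤s (hamming-step x z y (i , ne , λ ne′ → suc-injective (uniq ne′)))

  hamming-shortest : ∀ {n k} {x y : Vec Bool n} →
                     Walk DifferInOne x y k → hamming x y ≤ k
  hamming-shortest {x = x} here = ≤-reflexive (hamming-refl x)
  hamming-shortest {x = x} {y} (step {y = z} e w) =
    ≤-trans (hamming-step x z y e) (s≤s (hamming-shortest w))

hypercube : ℕ → ConnectedGraph
hypercube n = record
  { Vertex     = Vec Bool n
  ; Adj        = DifferInOne
  ; adj-sym    = λ {x} {y} → differ-sym {x = x} {y}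
  ; adj-irrefl = λ (i , ne , _) → ne refl
  ; d          = hamming
  ; d-distance = record { attained = hamming-walk ; shortest = hamming-shortest }
  }

zeroAt : ∀ {n} → Fin n → Vec Bool n
zeroAt {n} i = replicate n true [ i ]≔ false

zeroAt-injective : ∀ {n} {i j : Fin n} → zeroAt i ≡ zeroAt j → i ≡ j
zeroAt-injective {i = zero}  {zero}  _  = refl
zeroAt-injective {i = suc i} {suc j} eq = cong suc (zeroAt-injective (cong tail eq))

zeroAtNonLast : ∀ n → OrderedSubset (Vec Bool n)
zeroAtNonLast n = orderedSubset
  (List.tabulate {n = n ∸ 1} λ i → zeroAt (inject≤ i n∸1≤n))
  (tabulate⁺ λ eq → inject≤-injective n∸1≤n n∸1≤n _ _ (zeroAt-injective eq))
  where
  n∸1≤n : n ∸ 1 ≤ n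
  n∸1≤n = m∸n≤m n 1

{-# OPTIONS --safe #-}
module Submission where

-- Write z x for the number of zeros of x. The distance from x to the string with
-- its only zero at i is z x ± 1, with sign − exactly when xᵢ = 0. Let x and y have
-- the same distances. If z x = z y, they agree on all but the last coordinate,
-- hence everywhere. Otherwise, up to symmetry, z y = z x + 2 while xᵢ = 1 and
-- yᵢ = 0 for all i < n, so n − 1 ≤ z y = z x + 2 ≤ 3.
-- For minimality, distinct strings with a single zero are at distance 2, so if the
-- string with its zero at i is removed, then it has the same distances to the
-- remaining ones as the string with its zero in the last position.

open import Defs
open import Data.Bool using (Bool; true; false; _≟_; if_then_else_)
open import Data.Empty using (⊥; ⊥-elim)
open import Data.Fin using (Fin; zero; suc; inject≤; fromℕ)
open import Data.Fin.Properties using (suc-injective)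
open import Data.List as List using (List; []; _∷_)
import Data.List.Membership.DecPropositional as DecMembership
open import Data.List.Membership.Propositional using (_∈_)
open import Data.List.Membership.Propositional.Properties using (∈-tabulate⁻)
open import Data.List.Properties using (map-cong-local; ∷-injective)
open import Data.List.Relation.Unary.All as All using (All; []; _∷_)
open import Data.List.Relation.Unary.All.Properties using (tabulate⁻)
open import Data.Nat using (ℕ; zero; suc; _+_; _≤_; _<_; _≥_; z≤n; s≤s)
open import Data.Nat.Properties as ℕₚ
  using (≤-refl; n≤0⇒n≡0; n≤1+n; <-cmp; <⇒≱; +-cancelˡ-≡; +-cancelˡ-<; +-identityʳ; +-comm)
open import Data.Product using (_×_; _,_; proj₁; proj₂)
open import Data.Vec using (Vec; []; _∷_; lookup; replicate)
open import Data.Vec.Properties using (≡-dec; lookup∘update; lookup∘update′; lookup-replicate)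
open import Function using (_∘_)
open import Relation.Binary.Definitions using (tri<; tri≈; tri>)
open import Relation.Binary.PropositionalEquality
  using (_≡_; _≢_; refl; sym; trans; cong; cong₂; subst; module ≡-Reasoning)
open import Relation.Nullary using (yes; no)

map-≡⁻ : {A B : Set} {f g : A → B} (xs : List A) →
         List.map f xs ≡ List.map g xs → All (λ x → f x ≡ g x) xs
map-≡⁻ []       _  = []
map-≡⁻ (x ∷ xs) eq = proj₁ (∷-injective eq) ∷ map-≡⁻ xs (proj₂ (∷-injective eq))

-- Built with `inject≤` as in `zeroAtNonLast`, so the entries of that list are definitionally
-- `zeroAt (nonLast i)`.
nonLast : ∀ {m} → Fin m → Fin (suc m)
nonLast {m} i = inject≤ i (n≤1+n m)

nonLast≢fromℕ : ∀ {m} (i : Fin m) → nonLast i ≢ fromℕ m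
nonLast≢fromℕ (suc i) eq = nonLast≢fromℕ i (suc-injective eq)

-- As a distance to the all-true string, this is what remains of `hamming x (zeroAt zero)` past the
-- head.
zeros : ∀ {n} → Vec Bool n → ℕ
zeros {n} x = hamming x (replicate n true)

-- Added to the distance, so that no truncated subtraction occurs in z x − 1.
offset : Bool → ℕ
offset b = if b then 0 else 2

offset-injective : ∀ a b → offset a ≡ offset b → a ≡ b
offset-injective false false _ = refl
offset-injective true  true  _ = refl

offset-< : ∀ a b → offset a < offset b → a ≡ true × b ≡ false
offset-< true  false _               = refl , refl
offset-< false false (s≤s (s≤s ()))

-- Flipping coordinate `i` of the all-true string moves it away from `x` by 1 if `x` is true there,
-- and towards `x` by 1 otherwise; the offset levels both cases.
hamming-zeroAt : ∀ {n} (x : Vec Bool n) i →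
                 hamming x (zeroAt i) + offset (lookup x i) ≡ suc (zeros x)
hamming-zeroAt (true  ∷ x) zero    = +-identityʳ _
hamming-zeroAt (false ∷ x) zero    = +-comm _ 2
hamming-zeroAt (true  ∷ x) (suc i) = hamming-zeroAt x i
hamming-zeroAt (false ∷ x) (suc i) = cong suc (hamming-zeroAt x i)

hamming-refl : ∀ {n} (x : Vec Bool n) → hamming x x ≡ 0
hamming-refl {n} x = n≤0⇒n≡0 (shortest (here {x = x}))
  where open IsGraphDistance (ConnectedGraph.d-distance (hypercube n))

lookup-zeroAt : ∀ {n} (i : Fin n) → lookup (zeroAt i) i ≡ false
lookup-zeroAt i = lookup∘update i (replicate _ true) false

lookup-zeroAt-≢ : ∀ {n} {i j : Fin n} → i ≢ j → lookup (zeroAt i) j ≡ true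
lookup-zeroAt-≢ {j = j} i≢j =
  trans (lookup∘update′ (i≢j ∘ sym) (replicate _ true) false) (lookup-replicate j true)

-- Measured against itself, `zeroAt i` has distance 0 and offset 2.
zeros-zeroAt : ∀ {n} (i : Fin n) → zeros (zeroAt i) ≡ 1
zeros-zeroAt i = ℕₚ.suc-injective (begin
  suc (zeros (zeroAt i))
    ≡⟨ hamming-zeroAt (zeroAt i) i ⟨
  hamming (zeroAt i) (zeroAt i) + offset (lookup (zeroAt i) i)
    ≡⟨ cong₂ _+_ (hamming-refl (zeroAt i)) (cong offset (lookup-zeroAt i)) ⟩
  2 ∎)
  where open ≡-Reasoning

hamming-zeroAt-≢ : ∀ {n} {i j : Fin n} → i ≢ j → hamming (zeroAt i) (zeroAt j) ≡ 2
hamming-zeroAt-≢ {i = i} {j} i≢j = begin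
  hamming (zeroAt i) (zeroAt j)
    ≡⟨ +-identityʳ _ ⟨
  hamming (zeroAt i) (zeroAt j) + 0
    ≡⟨ cong (λ b → hamming (zeroAt i) (zeroAt j) + offset b) (lookup-zeroAt-≢ i≢j) ⟨
  hamming (zeroAt i) (zeroAt j) + offset (lookup (zeroAt i) j)
    ≡⟨ hamming-zeroAt (zeroAt i) j ⟩
  suc (zeros (zeroAt i))
    ≡⟨ cong suc (zeros-zeroAt i) ⟩
  2 ∎
  where open ≡-Reasoning

module _ {n} (x y : Vec Bool n) i (eq : hamming x (zeroAt i) ≡ hamming y (zeroAt i)) where

  private
    hamming-zeroAt-y : hamming x (zeroAt i) + offset (lookup y i) ≡ suc (zeros y)
    hamming-zeroAt-y = trans (cong (_+ offset (lookup y i)) eq) (hamming-zeroAt y i)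

  zeros-≡⇒lookup-≡ : zeros x ≡ zeros y → lookup x i ≡ lookup y i
  zeros-≡⇒lookup-≡ zx≡zy = offset-injective _ _ (+-cancelˡ-≡ (hamming x (zeroAt i)) _ _
    (trans (hamming-zeroAt x i) (trans (cong suc zx≡zy) (sym hamming-zeroAt-y))))

  -- Once the common distance is cancelled, more zeros means a larger offset at `i`, and 0 < 2 is
  -- the only possibility.
  zeros-<⇒lookup : zeros x < zeros y → lookup x i ≡ true × lookup y i ≡ false
  zeros-<⇒lookup zx<zy = offset-< _ _ (+-cancelˡ-< (hamming x (zeroAt i)) _ _ (begin-strict
    hamming x (zeroAt i) + offset (lookup x i)  ≡⟨ hamming-zeroAt x i ⟩
    suc (zeros x)                               <⟨ s≤s zx<zy ⟩
    suc (zeros y)                               ≡⟨ hamming-zeroAt-y ⟨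
    hamming x (zeroAt i) + offset (lookup y i)  ∎))
    where open ℕₚ.≤-Reasoning

  zeros-<⇒gap : zeros x < zeros y → zeros y ≡ 2 + zeros x
  zeros-<⇒gap zx<zy with xᵢ≡true , yᵢ≡false ← zeros-<⇒lookup zx<zy = ℕₚ.suc-injective (begin
    suc (zeros y)
      ≡⟨ hamming-zeroAt-y ⟨
    hamming x (zeroAt i) + offset (lookup y i)
      ≡⟨ cong (λ b → hamming x (zeroAt i) + offset b) yᵢ≡false ⟩
    hamming x (zeroAt i) + 2
      ≡⟨ +-comm _ 2 ⟩
    2 + hamming x (zeroAt i)
      ≡⟨ cong (2 +_) (+-identityʳ _) ⟨
    2 + (hamming x (zeroAt i) + 0)
      ≡⟨ cong (λ b → 2 + (hamming x (zeroAt i) + offset b)) xᵢ≡true ⟨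
    2 + (hamming x (zeroAt i) + offset (lookup x i))
      ≡⟨ cong (2 +_) (hamming-zeroAt x i) ⟩
    3 + zeros x ∎)
    where open ≡-Reasoning

-- Only the last coordinate, which is left free, can contribute a zero.
nonLast-true⇒zeros≤1 : ∀ {m} (x : Vec Bool (suc m)) →
                       (∀ i → lookup x (nonLast i) ≡ true) → zeros x ≤ 1
nonLast-true⇒zeros≤1 {zero}  (true  ∷ []) _  = z≤n
nonLast-true⇒zeros≤1 {zero}  (false ∷ []) _  = ≤-refl
nonLast-true⇒zeros≤1 {suc m} (a ∷ x)      eq with refl ← eq zero =
  nonLast-true⇒zeros≤1 x (eq ∘ suc)

nonLast-false⇒zeros≥ : ∀ {m} (x : Vec Bool (suc m)) →
                       (∀ i → lookup x (nonLast i) ≡ false) → m ≤ zeros x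
nonLast-false⇒zeros≥ {zero}  _       _  = z≤n
nonLast-false⇒zeros≥ {suc m} (a ∷ x) eq with refl ← eq zero =
  s≤s (nonLast-false⇒zeros≥ x (eq ∘ suc))

-- Equal prefixes contribute equally many zeros, so equal totals force the last bits to agree too.
nonLast-zeros-ext : ∀ {m} (x y : Vec Bool (suc m)) →
                    (∀ i → lookup x (nonLast i) ≡ lookup y (nonLast i)) →
                    zeros x ≡ zeros y → x ≡ y
nonLast-zeros-ext {zero}  (true  ∷ []) (true  ∷ []) _ _ = refl
nonLast-zeros-ext {zero}  (false ∷ []) (false ∷ []) _ _ = refl
nonLast-zeros-ext {suc m} (a ∷ x) (b ∷ y) eq zx≡zy with eq zero
nonLast-zeros-ext {suc m} (true  ∷ x) (_ ∷ y) eq zx≡zy | refl =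
  cong (true ∷_) (nonLast-zeros-ext x y (eq ∘ suc) zx≡zy)
nonLast-zeros-ext {suc m} (false ∷ x) (_ ∷ y) eq zx≡zy | refl =
  cong (false ∷_) (nonLast-zeros-ext x y (eq ∘ suc) (ℕₚ.suc-injective zx≡zy))

SameDistances : ∀ {m} → Vec Bool (suc m) → Vec Bool (suc m) → Set
SameDistances x y = ∀ i → hamming x (zeroAt (nonLast i)) ≡ hamming y (zeroAt (nonLast i))

sameDistances⇒zeros-≮ : ∀ {m} → 4 ≤ m → (x y : Vec Bool (suc m)) →
                        SameDistances x y → zeros x < zeros y → ⊥
-- A nonzero `m` supplies an index at which to read off the gap of 2.
sameDistances⇒zeros-≮ {m@(suc _)} 4≤m x y same zx<zy = <⇒≱ 4≤m (begin
  m            ≤⟨ nonLast-false⇒zeros≥ y (λ i → proj₂ (bits i)) ⟩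
  zeros y      ≡⟨ zeros-<⇒gap x y (nonLast zero) (same zero) zx<zy ⟩
  2 + zeros x  ≤⟨ s≤s (s≤s (nonLast-true⇒zeros≤1 x (λ i → proj₁ (bits i)))) ⟩
  3            ∎)
  where
  open ℕₚ.≤-Reasoning
  bits : ∀ i → lookup x (nonLast i) ≡ true × lookup y (nonLast i) ≡ false
  bits i = zeros-<⇒lookup x y (nonLast i) (same i) zx<zy

sameDistances⇒≡ : ∀ {m} → 4 ≤ m → (x y : Vec Bool (suc m)) → SameDistances x y → x ≡ y
sameDistances⇒≡ 4≤m x y same with <-cmp (zeros x) (zeros y)
... | tri< zx<zy _ _ = ⊥-elim (sameDistances⇒zeros-≮ 4≤m x y same zx<zy)
... | tri> _ _ zy<zx = ⊥-elim (sameDistances⇒zeros-≮ 4≤m y x (sym ∘ same) zy<zx)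
... | tri≈ _ zx≡zy _ =
  nonLast-zeros-ext x y (λ i → zeros-≡⇒lookup-≡ x y (nonLast i) (same i) zx≡zy) zx≡zy

zeroAtNonLast-resolving : ∀ {m} → 4 ≤ m →
                          Resolving (hypercube (suc m)) (zeroAtNonLast (suc m))
zeroAtNonLast-resolving {m} 4≤m x y x≢y eq =
  x≢y (sameDistances⇒≡ 4≤m x y (tabulate⁻ (map-≡⁻ (elements (zeroAtNonLast (suc m))) eq)))

zeroAtNonLast-minimal : ∀ {m} T → T ⊊ zeroAtNonLast (suc m) →
                        Resolving (hypercube (suc m)) T → ⊥
zeroAtNonLast-minimal {m} T (T⊆S , S⊈T) resolving = S⊈T S⊆T
  where
  open DecMembership (≡-dec {n = suc m} _≟_) using (_∈?_)

  S⊆T : ∀ {x} → x ∈ elements (zeroAtNonLast (suc m)) → x ∈ elements T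
  -- `⊊` names no missing element, so membership in `T` is decided for each `x`, and a missing `x`
  -- is turned into a pair that `T` fails to separate.
  S⊆T {x} x∈S with ∈-tabulate⁻ x∈S | x ∈? elements T
  ... | _        | yes x∈T = x∈T
  ... | i , refl | no  x∉T = ⊥-elim (resolving (zeroAt (nonLast i)) (zeroAt (fromℕ m))
    (nonLast≢fromℕ i ∘ zeroAt-injective)
    (map-cong-local (All.tabulate equidistant)))
    where
    equidistant : ∀ {t} → t ∈ elements T →
                  hamming (zeroAt (nonLast i)) t ≡ hamming (zeroAt (fromℕ m)) t
    equidistant t∈T with j , refl ← ∈-tabulate⁻ (T⊆S t∈T) =
      -- Both distances are 2: `i ≡ j` would put the missing string into `T`, and `fromℕ m` is never
      -- of the form `nonLast j`.
      trans (hamming-zeroAt-≢ λ i≡j → x∉T (subst (λ k → zeroAt k ∈ elements T) (sym i≡j) t∈T))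
            (sym (hamming-zeroAt-≢ (nonLast≢fromℕ j ∘ sym)))

corollary4 : (n : ℕ) → n ≥ 5 → MinimalResolving (hypercube n) (zeroAtNonLast n)
corollary4 (suc m) (s≤s 4≤m) = zeroAtNonLast-resolving 4≤m , zeroAtNonLast-minimal
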